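{- For every integer $k\ge 0$, $|I_k(132,231)|$ is equal to the number of partitions of $k$ into distinct parts.
   Context: A permutation of length $n$ is a word $\pi=\pi_1\cdots\pi_n$ containing each of $1,\dots,n$ exactly once. The sum of permutations $\rho=\rho_1\cdots\rho_n$ and $\tau=\tau_1\cdots\tau_m$ is the permutation $\rho\oplus\tau=\rho_1\cdots\rho_n(n+\tau_1)\cdots(n+\tau_m)$ of length $n+m$. A permutation is decomposable if it equals $\rho\oplus\tau$ for some non-empty permutations $\rho,\tau$; a non-empty permutation that is not decomposable is indecomposable. An inversion of $\pi$ is a pair $(i,j)$ with $i<j$ and $\pi_i>\pi_j$. A permutation $\pi$ contains a permutation (pattern) $\tau=\tau_1\cdots\tau_m$ if there are indices $i_1<\dots<i_m$ such that $\pi_{i_1},\dots,\pi_{i_m}$ is order-isomorphic to $\tau_1,\dots,\tau_m$; otherwise $\pi$ avoids $\tau$. $I_k(\tau_1,\dots,\tau_r)$ denotes the (finite) set of all indecomposable permutations, of any length, with exactly $k$ inversions that avoid all of $\tau_1,\dots,\tau_r$. -}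

module Defs where

open import Data.Fin.Base using (Fin) renaming (_<_ to _<ᶠ_)
open import Data.Fin.Properties using () renaming (_<?_ to _<ᶠ?_)
open import Data.List.Base
  using (List; []; _++_; length; lookup; map; filter; applyUpTo; allFin; cartesianProduct)
open import Data.List.Membership.Propositional using (_∈_)
open import Data.List.Relation.Binary.Permutation.Propositional using (_↭_)
open import Data.List.Relation.Unary.All using (All)
open import Data.List.Relation.Unary.Linked using (Linked)
open import Data.List.Relation.Unary.Unique.Propositional using (Unique)
open import Data.Nat.Base using (ℕ; suc; _+_; _<_; _>_; _≥_)
open import Data.Nat.ListAction using (sum)
open import Data.Nat.Properties using (_<?_)
open import Data.Product.Base using (∃-syntax; Σ-syntax; _×_; _,_)
open import Function.Bundles using (_⇔_)
open import Level using (Level; 0ℓ; _⊔_)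
open import Relation.Binary.PropositionalEquality using (_≡_; _≢_)
open import Relation.Nullary using (¬_)
open import Relation.Nullary.Decidable using (_×-dec_)
open import Relation.Unary using (Pred; Decidable)

private
  variable
    a p : Level

-- `P HasCardinality n` says that { x ∣ P x } is finite with exactly n
-- elements.  The elements x are counted, not the proofs of P x.
_HasCardinality_ : {A : Set a} → Pred A p → ℕ → Set (a ⊔ p)
_HasCardinality_ {A = A} P n =
  ∃[ xs ] Unique xs × (∀ (x : A) → x ∈ xs ⇔ P x) × length xs ≡ n

Word : Set
Word = List ℕ

-- `applyUpTo suc n` is the list 1 , … , n.
IsPermutation : Word → Set
IsPermutation π = π ↭ applyUpTo suc (length π)

infixr 5 _⊕_

_⊕_ : Word → Word → Word
ρ ⊕ τ = ρ ++ map (length ρ +_) τ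

Decomposable : Word → Set
Decomposable π =
  ∃[ ρ ] ∃[ τ ] IsPermutation ρ × IsPermutation τ × ρ ≢ [] × τ ≢ [] × π ≡ ρ ⊕ τ

Indecomposable : Word → Set
Indecomposable π = π ≢ [] × ¬ Decomposable π

IsInversion : (π : Word) → Pred (Fin (length π) × Fin (length π)) 0ℓ
IsInversion π (i , j) = i <ᶠ j × lookup π i > lookup π j

isInversion? : (π : Word) → Decidable (IsInversion π)
isInversion? π (i , j) = (i <ᶠ? j) ×-dec (lookup π j <? lookup π i)

inversions : Word → ℕ
inversions π =
  length (filter (isInversion? π) (cartesianProduct (allFin (length π)) (allFin (length π))))

-- The function f is the choice of indices i₁ < … < iₘ.
_Contains_ : Word → Word → Set
π Contains τ =
  Σ[ f ∈ (Fin (length τ) → Fin (length π)) ]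
      (∀ {a b} → a <ᶠ b → f a <ᶠ f b)
    × (∀ a b → lookup π (f a) < lookup π (f b) ⇔ lookup τ a < lookup τ b)

_Avoids_ : Word → Word → Set
π Avoids τ = ¬ (π Contains τ)

I : ℕ → List Word → Pred Word 0ℓ
I k τs π =
  IsPermutation π × Indecomposable π × inversions π ≡ k × All (π Avoids_) τs

-- A partition is represented by the list of its parts in weakly decreasing
-- order, so that each partition is counted once.
IsPartition : ℕ → Pred (List ℕ) 0ℓ
IsPartition k parts = Linked _≥_ parts × All (_> 0) parts × sum parts ≡ k

IsPartitionIntoDistinctParts : ℕ → Pred (List ℕ) 0ℓ
IsPartitionIntoDistinctParts k parts = IsPartition k parts × Unique parts

module Submission where

-- A word with distinct letters avoids both 132 and 231 exactly when no letter
-- has a smaller letter on each side.  In such a permutation of 1, ..., n the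
-- letter n therefore stands first or last, and removing it leaves a
-- permutation of 1, ..., n - 1 of the same kind.  So these permutations arise, each exactly once, from the
-- word 1 by adding 2, 3, ..., n in turn, each on the left or on the right end:
-- they are the words `arrange c`, for codes c that list the n - 1 choices
-- (`arrange-surjective`, `arrange-injective`).
--
-- A letter m added on the left is inverted with the m - 1 smaller letters,
-- and one added on the right creates no inversion.  Hence the number of
-- inversions is the sum of m - 1 over the letters m added on the left
-- (`inversions-arrange`), and these numbers m - 1 are the parts of a
-- partition into distinct parts (`parts`).  The permutation is indecomposable
-- iff n = 1 or n was added on the left; its code is then called canonical.
-- A canonical code is determined by its parts (`parts-injective`), because
-- n - 1 is either 0 or the largest of them.
--
-- Thus the canonical codes whose parts sum to k, which form an evidently
-- finite set (`codes-finite`), are in bijection with both of the sets to be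
-- counted.

open import Defs
open import Data.Empty using (⊥)
open import Data.Fin.Base using (Fin; zero; suc) renaming (_<_ to _<ᶠ_)
open import Data.List.Base
  using (List; []; _∷_; [_]; _++_; _∷ʳ_; length; lookup; map; filter; applyUpTo; allFin;
         cartesianProduct)
open import Data.List.Membership.Propositional using (_∈_)
open import Data.List.Membership.Propositional.Properties
  using (∈-map⁺; ∈-map⁻; ∈-++⁺ˡ; ∈-++⁺ʳ; ∈-∃++; ∈-filter⁺; ∈-filter⁻)
open import Data.List.Properties
  using (∷-injective; ∷-injectiveˡ; ∷-injectiveʳ; ∷ʳ-injectiveˡ; ++-identityʳ; length-++; length-map;
         length-applyUpTo; applyUpTo-∷ʳ; filter-++; filter-all; filter-none; map-∘; map-tabulate;
         tabulate-lookup)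
open import Data.List.Relation.Binary.Permutation.Propositional
  using (_↭_; prep; ↭-refl; ↭-sym; ↭-trans; ↭-reflexive; ↭⇒↭ₛ)
open import Data.List.Relation.Binary.Permutation.Propositional.Properties
  using (↭-length; ↭-singleton-inv; All-resp-↭; ∈-resp-↭; ∷↭∷ʳ; ++⁺ʳ; drop-mid)
import Data.List.Relation.Binary.Permutation.Setoid.Properties as Permutationₛ
open import Data.List.Relation.Unary.All as All using (All; []; _∷_)
import Data.List.Relation.Unary.All.Properties as All
open import Data.List.Relation.Unary.AllPairs as AllPairs using (AllPairs; []; _∷_)
import Data.List.Relation.Unary.AllPairs.Properties as AllPairs
open import Data.List.Relation.Unary.Any using (here; there)
open import Data.List.Relation.Unary.Linked.Properties using (AllPairs⇒Linked; Linked⇒AllPairs)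
open import Data.List.Relation.Unary.Unique.Propositional using (Unique)
import Data.List.Relation.Unary.Unique.Propositional.Properties as Unique
open import Data.Nat.Base
  using (ℕ; zero; suc; _+_; _≤_; _<_; _>_; z≤n; s≤s; z<s; s<s; s≤s⁻¹)
open import Data.Nat.ListAction using (sum)
open import Data.Nat.Properties
open import Data.Product.Base using (∃-syntax; _×_; _,_; proj₂)
open import Data.Unit.Base using (⊤; tt)
open import Function.Base using (_∘_; id; case_of_)
open import Function.Bundles using (_⇔_; mk⇔; Equivalence)
open import Level using (Level)
open import Relation.Binary.Core using (Rel)
open import Relation.Binary.Definitions using (tri<; tri≈; tri>)
open import Relation.Binary.PropositionalEquality
  using (_≡_; _≢_; refl; sym; trans; cong; cong₂; subst; setoid; module ≡-Reasoning)
open import Relation.Nullary using (¬_; yes; no; contradiction)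
open import Relation.Nullary.Decidable using (_×-dec_)
open import Relation.Unary using (Pred; Decidable)

private
  variable
    a b p q r : Level
    A : Set a
    B : Set b

-- Lists

Unique-map : {P : Pred A p} (f : A → B) → (∀ {x y} → P x → P y → f x ≡ f y → x ≡ y) →
             ∀ {xs} → All P xs → Unique xs → Unique (map f xs)
Unique-map f inj []         []          = []
Unique-map f inj (px ∷ pxs) (x∉xs ∷ u) =
  All.map⁺ (All.zipWith (λ (py , x≢y) fx≡fy → x≢y (inj px py fx≡fy)) (pxs , x∉xs))
    ∷ Unique-map f inj pxs u

-- A bijection from P onto Q preserves the cardinality.
HasCardinality-map :
  {P : Pred A p} {Q : Pred B q} {n : ℕ} (f : A → B) →
  (∀ {x y} → P x → P y → f x ≡ f y → x ≡ y) →
  (∀ {x} → P x → Q (f x)) →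
  (∀ {y} → Q y → ∃[ x ] P x × y ≡ f x) →
  P HasCardinality n → Q HasCardinality n
HasCardinality-map {P = P} {Q = Q} f inj sound complete (xs , unique , xs⇔P , len) =
  map f xs
  , Unique-map f inj (All.tabulate (λ x∈xs → Equivalence.to (xs⇔P _) x∈xs)) unique
  , (λ y → mk⇔ to from)
  , trans (length-map f xs) len
  where
  to : ∀ {y} → y ∈ map f xs → Q y
  to y∈ with x , x∈xs , refl ← ∈-map⁻ f y∈ = sound (Equivalence.to (xs⇔P x) x∈xs)

  from : ∀ {y} → Q y → y ∈ map f xs
  from qy with x , px , refl ← complete qy = ∈-map⁺ f (Equivalence.from (xs⇔P x) px)

length-filter-map :
  {P : Pred B p} {Q : Pred A q} (P? : Decidable P) (Q? : Decidable Q) (f : A → B) →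
  (∀ x → P (f x) ⇔ Q x) → ∀ xs → length (filter P? (map f xs)) ≡ length (filter Q? xs)
length-filter-map P? Q? f eqv []       = refl
length-filter-map P? Q? f eqv (x ∷ xs) with P? (f x) | Q? x
... | yes _  | yes _  = cong suc (length-filter-map P? Q? f eqv xs)
... | no _   | no _   = length-filter-map P? Q? f eqv xs
... | yes pf | no ¬q  = contradiction (Equivalence.to (eqv x) pf) ¬q
... | no ¬p  | yes qx = contradiction (Equivalence.from (eqv x) qx) ¬p

length-filter-++ : {P : Pred A p} (P? : Decidable P) → ∀ xs ys →
  length (filter P? (xs ++ ys)) ≡ length (filter P? xs) + length (filter P? ys)
length-filter-++ P? xs ys = trans (cong length (filter-++ P? xs ys)) (length-++ (filter P? xs))

All-lookup : {P : Pred A p} → ∀ {xs} → All P xs → ∀ i → P (lookup xs i)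
All-lookup (px ∷ pxs) zero    = px
All-lookup (px ∷ pxs) (suc i) = All-lookup pxs i

All-tabulate : {P : Pred A p} → ∀ xs → (∀ i → P (lookup xs i)) → All P xs
All-tabulate []       h = []
All-tabulate (x ∷ xs) h = h zero ∷ All-tabulate xs (h ∘ suc)

AllPairs-lookup : {R : Rel A r} → ∀ {xs} → AllPairs R xs →
                  ∀ {i j} → i <ᶠ j → R (lookup xs i) (lookup xs j)
AllPairs-lookup (rx ∷ rxs) {zero}  {suc j} _         = All-lookup rx j
AllPairs-lookup (rx ∷ rxs) {suc i} {suc j} (s<s i<j) = AllPairs-lookup rxs i<j

AllPairs-tabulate : {R : Rel A r} → ∀ xs →
                    (∀ {i j} → i <ᶠ j → R (lookup xs i) (lookup xs j)) → AllPairs R xs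
AllPairs-tabulate []       h = []
AllPairs-tabulate (x ∷ xs) h =
  All-tabulate xs (λ j → h {zero} {suc j} z<s)
    ∷ AllPairs-tabulate xs (λ {i} {j} i<j → h {suc i} {suc j} (s<s i<j))

AllPairs-++⁻ˡ : {R : Rel A r} → ∀ xs {ys} → AllPairs R (xs ++ ys) → AllPairs R xs
AllPairs-++⁻ˡ []       _          = []
AllPairs-++⁻ˡ (x ∷ xs) (rx ∷ rxs) = All.++⁻ˡ xs rx ∷ AllPairs-++⁻ˡ xs rxs

AllPairs-++⁻ʳ : {R : Rel A r} → ∀ xs {ys} → AllPairs R (xs ++ ys) → AllPairs R ys
AllPairs-++⁻ʳ []       rxs       = rxs
AllPairs-++⁻ʳ (x ∷ xs) (_ ∷ rxs) = AllPairs-++⁻ʳ xs rxs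

-- Permutations of 1, ..., n

permutation-bounded : ∀ {n π} → π ↭ applyUpTo suc n → All (_≤ n) π
permutation-bounded {n} π↭ = All-resp-↭ (↭-sym π↭) (All.applyUpTo⁺₁ suc n id)

permutation-unique : ∀ {n π} → π ↭ applyUpTo suc n → Unique π
permutation-unique {n} π↭ =
  Permutationₛ.Unique-resp-↭ (setoid ℕ) (↭⇒↭ₛ (↭-sym π↭))
    (Unique.applyUpTo⁺₁ suc n (λ i<j _ → <⇒≢ (s<s i<j)))

-- The number of inversions

module _ (x : ℕ) (π : Word) where

  private
    F = allFin (length π)

    -- The pairs of indices whose first component is zero.
    row-zero :
      length (filter (isInversion? (x ∷ π)) (map (zero ,_) (zero ∷ map suc F)))
        ≡ length (filter (_<? x) π)
    row-zero = begin
      length (filter (isInversion? (x ∷ π)) (map (zero ,_) (map suc F)))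
        ≡⟨ cong (length ∘ filter (isInversion? (x ∷ π))) (map-∘ F) ⟨
      length (filter (isInversion? (x ∷ π)) (map (λ j → zero , suc j) F))
        ≡⟨ length-filter-map (isInversion? (x ∷ π)) (λ j → lookup π j <? x) _
             (λ j → mk⇔ proj₂ (z<s ,_)) F ⟩
      length (filter (λ j → lookup π j <? x) F)
        ≡⟨ length-filter-map (_<? x) (λ j → lookup π j <? x) (lookup π) (λ _ → mk⇔ id id) F ⟨
      length (filter (_<? x) (map (lookup π) F))
        ≡⟨ cong (length ∘ filter (_<? x)) (trans (map-tabulate id (lookup π)) (tabulate-lookup π)) ⟩
      length (filter (_<? x) π) ∎
      where open ≡-Reasoning

    -- The pairs of indices whose first component is not zero; the inversions
    -- among them have a second component that is not zero either.
    rows-suc : ∀ is →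
      length (filter (isInversion? (x ∷ π)) (cartesianProduct (map suc is) (zero ∷ map suc F)))
        ≡ length (filter (isInversion? π) (cartesianProduct is F))
    rows-suc []       = refl
    rows-suc (i ∷ is) = begin
      length (filter P? (map (suc i ,_) (map suc F) ++ cartesianProduct (map suc is) (zero ∷ map suc F)))
        ≡⟨ length-filter-++ P? (map (suc i ,_) (map suc F)) _ ⟩
      length (filter P? (map (suc i ,_) (map suc F)))
        + length (filter P? (cartesianProduct (map suc is) (zero ∷ map suc F)))
        ≡⟨ cong₂ _+_ row (rows-suc is) ⟩
      length (filter Q? (map (i ,_) F)) + length (filter Q? (cartesianProduct is F))
        ≡⟨ length-filter-++ Q? (map (i ,_) F) _ ⟨
      length (filter Q? (map (i ,_) F ++ cartesianProduct is F)) ∎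
      where
      open ≡-Reasoning
      P? = isInversion? (x ∷ π)
      Q? = isInversion? π

      row : length (filter P? (map (suc i ,_) (map suc F))) ≡ length (filter Q? (map (i ,_) F))
      row = begin
        length (filter P? (map (suc i ,_) (map suc F)))
          ≡⟨ cong (length ∘ filter P?) (map-∘ F) ⟨
        length (filter P? (map (λ j → suc i , suc j) F))
          ≡⟨ cong (length ∘ filter P?) (map-∘ F) ⟩
        length (filter P? (map (λ (i , j) → suc i , suc j) (map (i ,_) F)))
          ≡⟨ length-filter-map P? Q? _
               (λ _ → mk⇔ (λ (i<j , v) → s≤s⁻¹ i<j , v) (λ (i<j , v) → s<s i<j , v)) (map (i ,_) F) ⟩
        length (filter Q? (map (i ,_) F)) ∎

  inversions-∷ : inversions (x ∷ π) ≡ length (filter (_<? x) π) + inversions π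
  inversions-∷ = begin
    inversions (x ∷ π)
      ≡⟨ cong (λ js → length (filter P? (cartesianProduct (zero ∷ js) (zero ∷ js))))
           (map-tabulate id suc) ⟨
    length (filter P? (map (zero ,_) (zero ∷ map suc F) ++ cartesianProduct (map suc F) (zero ∷ map suc F)))
      ≡⟨ length-filter-++ P? (map (zero ,_) (zero ∷ map suc F)) _ ⟩
    length (filter P? (map (zero ,_) (zero ∷ map suc F)))
      + length (filter P? (cartesianProduct (map suc F) (zero ∷ map suc F)))
      ≡⟨ cong₂ _+_ row-zero (rows-suc F) ⟩
    length (filter (_<? x) π) + inversions π ∎
    where
    open ≡-Reasoning
    P? = isInversion? (x ∷ π)

inversions-max-first : ∀ {m π} → All (_< m) π → inversions (m ∷ π) ≡ length π + inversions π
inversions-max-first {m} {π} π<m =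
  trans (inversions-∷ m π) (cong (λ ys → length ys + inversions π) (filter-all (_<? m) π<m))

inversions-max-last : ∀ {m π} → All (_≤ m) π → inversions (π ∷ʳ m) ≡ inversions π
inversions-max-last                  []          = refl
inversions-max-last {m} {x ∷ π} (x≤m ∷ π≤m) = begin
  inversions (x ∷ π ∷ʳ m)
    ≡⟨ inversions-∷ x (π ∷ʳ m) ⟩
  length (filter (_<? x) (π ∷ʳ m)) + inversions (π ∷ʳ m)
    ≡⟨ cong₂ _+_ smaller (inversions-max-last π≤m) ⟩
  length (filter (_<? x) π) + inversions π
    ≡⟨ inversions-∷ x π ⟨
  inversions (x ∷ π) ∎
  where
  open ≡-Reasoning

  smaller : length (filter (_<? x) (π ∷ʳ m)) ≡ length (filter (_<? x) π)
  smaller = begin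
    length (filter (_<? x) (π ∷ʳ m))
      ≡⟨ length-filter-++ (_<? x) π [ m ] ⟩
    length (filter (_<? x) π) + length (filter (_<? x) [ m ])
      ≡⟨ cong (λ ys → length (filter (_<? x) π) + length ys) (filter-none (_<? x) (≤⇒≯ x≤m ∷ [])) ⟩
    length (filter (_<? x) π) + 0
      ≡⟨ +-identityʳ _ ⟩
    length (filter (_<? x) π) ∎

-- Avoidance of 132 and 231

132∧231 : List Word
132∧231 = (1 ∷ 3 ∷ 2 ∷ []) ∷ (2 ∷ 3 ∷ 1 ∷ []) ∷ []

-- No letter has a smaller letter somewhere to its left and another one
-- somewhere to its right.  The constructor _∷_ treats the triples x, y, z in
-- which x is the first letter of the word.
data PeakFree : Pred Word Level.zero where
  []  : PeakFree []
  _∷_ : ∀ {x xs} → AllPairs (λ y z → ¬ (x < y × z < y)) xs → PeakFree xs → PeakFree (x ∷ xs)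

-- The same condition in terms of indices; the converse is peakFree-tabulate.
peakFree-lookup : ∀ {π} → PeakFree π → ∀ {i j k} → i <ᶠ j → j <ᶠ k →
                  ¬ (lookup π i < lookup π j × lookup π k < lookup π j)
peakFree-lookup (px ∷ _)   {zero}  {suc j} {suc k} _         (s<s j<k) = AllPairs-lookup px j<k
peakFree-lookup (_  ∷ pxs) {suc i} {suc j} {suc k} (s<s i<j) (s<s j<k) = peakFree-lookup pxs i<j j<k

peakFree-tabulate : ∀ π → (∀ {i j k} → i <ᶠ j → j <ᶠ k →
                           ¬ (lookup π i < lookup π j × lookup π k < lookup π j)) → PeakFree π
peakFree-tabulate []      h = []
peakFree-tabulate (x ∷ π) h =
  AllPairs-tabulate π (λ {j} {k} j<k → h {zero} {suc j} {suc k} z<s (s<s j<k))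
    ∷ peakFree-tabulate π (λ {i} {j} {k} i<j j<k → h {suc i} {suc j} {suc k} (s<s i<j) (s<s j<k))

peakFree⇒avoids : ∀ {π} → PeakFree π → All (π Avoids_) 132∧231
peakFree⇒avoids pf =
    (λ (f , mono , iso) → peakFree-lookup pf (mono {zero} 0<1) (mono {suc zero} 1<2)
      (Equivalence.from (iso zero (suc zero)) (s<s z<s)
      , Equivalence.from (iso (suc (suc zero)) (suc zero)) (s<s (s<s z<s))))
  ∷ (λ (f , mono , iso) → peakFree-lookup pf (mono {zero} 0<1) (mono {suc zero} 1<2)
      (Equivalence.from (iso zero (suc zero)) (s<s (s<s z<s))
      , Equivalence.from (iso (suc (suc zero)) (suc zero)) (s<s z<s)))
  ∷ []
  where
  0<1 : zero {2} <ᶠ suc {2} zero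
  0<1 = z<s
  1<2 : suc {2} zero <ᶠ suc {2} (suc zero)
  1<2 = s<s z<s

module _ (π : Word) {i j k : Fin (length π)} (i<j : i <ᶠ j) (j<k : j <ᶠ k) where

  private
    triple : Fin 3 → Fin (length π)
    triple zero             = i
    triple (suc zero)       = j
    triple (suc (suc zero)) = k

    triple-mono : ∀ {a b} → a <ᶠ b → triple a <ᶠ triple b
    triple-mono {zero}             {suc zero}       _ = i<j
    triple-mono {zero}             {suc (suc zero)} _ = <-trans i<j j<k
    triple-mono {suc zero}         {suc zero}       (s<s ())
    triple-mono {suc zero}         {suc (suc zero)} _ = j<k
    triple-mono {suc (suc zero)}   {suc zero}       (s<s ())
    triple-mono {suc (suc zero)}   {suc (suc zero)} (s<s (s<s ()))

    both-< : ∀ {u v u′ v′} → u < v → u′ < v′ → (u < v) ⇔ (u′ < v′)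
    both-< u<v u′<v′ = mk⇔ (λ _ → u′<v′) (λ _ → u<v)

    both-> : ∀ {u v u′ v′} → v < u → v′ < u′ → (u < v) ⇔ (u′ < v′)
    both-> v<u v′<u′ = mk⇔ (λ u<v → contradiction u<v (<-asym v<u))
                           (λ u′<v′ → contradiction u′<v′ (<-asym v′<u′))

    both-≡ : ∀ {u u′} → (u < u) ⇔ (u′ < u′)
    both-≡ = mk⇔ (λ u<u → contradiction u<u (<-irrefl refl))
                 (λ u<u → contradiction u<u (<-irrefl refl))

    1<2 : 1 < 2
    1<2 = s<s z<s
    1<3 : 1 < 3
    1<3 = s<s z<s
    2<3 : 2 < 3
    2<3 = s<s (s<s z<s)

  contains-132 : lookup π i < lookup π k → lookup π k < lookup π j → π Contains (1 ∷ 3 ∷ 2 ∷ [])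
  contains-132 πi<πk πk<πj = triple , triple-mono , iso
    where
    πi<πj = <-trans πi<πk πk<πj

    iso : ∀ a b → _ ⇔ _
    iso zero             zero             = both-≡
    iso zero             (suc zero)       = both-< πi<πj 1<3
    iso zero             (suc (suc zero)) = both-< πi<πk 1<2
    iso (suc zero)       zero             = both-> πi<πj 1<3
    iso (suc zero)       (suc zero)       = both-≡
    iso (suc zero)       (suc (suc zero)) = both-> πk<πj 2<3
    iso (suc (suc zero)) zero             = both-> πi<πk 1<2
    iso (suc (suc zero)) (suc zero)       = both-< πk<πj 2<3
    iso (suc (suc zero)) (suc (suc zero)) = both-≡

  contains-231 : lookup π k < lookup π i → lookup π i < lookup π j → π Contains (2 ∷ 3 ∷ 1 ∷ [])
  contains-231 πk<πi πi<πj = triple , triple-mono , iso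
    where
    πk<πj = <-trans πk<πi πi<πj

    iso : ∀ a b → _ ⇔ _
    iso zero             zero             = both-≡
    iso zero             (suc zero)       = both-< πi<πj 2<3
    iso zero             (suc (suc zero)) = both-> πk<πi 1<2
    iso (suc zero)       zero             = both-> πi<πj 2<3
    iso (suc zero)       (suc zero)       = both-≡
    iso (suc zero)       (suc (suc zero)) = both-> πk<πj 1<3
    iso (suc (suc zero)) zero             = both-< πk<πi 1<2
    iso (suc (suc zero)) (suc zero)       = both-< πk<πj 1<3
    iso (suc (suc zero)) (suc (suc zero)) = both-≡

-- By uniqueness of the letters, the smaller letters around a peak are distinct, so
-- they form with it either the pattern 132 or the pattern 231.
avoids⇒peakFree : ∀ {π} → Unique π → All (π Avoids_) 132∧231 → PeakFree π
avoids⇒peakFree {π} unique (avoids-132 ∷ avoids-231 ∷ []) = peakFree-tabulate π noPeak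
  where
  noPeak : ∀ {i j k} → i <ᶠ j → j <ᶠ k → ¬ (lookup π i < lookup π j × lookup π k < lookup π j)
  noPeak {i} {j} {k} i<j j<k (πi<πj , πk<πj) with <-cmp (lookup π i) (lookup π k)
  ... | tri< πi<πk _ _ = avoids-132 (contains-132 π i<j j<k πi<πk πk<πj)
  ... | tri≈ _ πi≡πk _ = AllPairs-lookup unique (<-trans i<j j<k) πi≡πk
  ... | tri> _ _ πk<πi = avoids-231 (contains-231 π i<j j<k πk<πi πi<πj)

peakFree-max-first : ∀ {m π} → All (_≤ m) π → PeakFree π → PeakFree (m ∷ π)
peakFree-max-first π≤m pf = noneAbove π≤m ∷ pf
  where
  noneAbove : ∀ {m ys} → All (_≤ m) ys → AllPairs (λ y z → ¬ (m < y × z < y)) ys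
  noneAbove []           = []
  noneAbove (y≤m ∷ ys≤m) = All.universal (λ _ (m<y , _) → ≤⇒≯ y≤m m<y) _ ∷ noneAbove ys≤m

peakFree-max-last : ∀ {m π} → All (_≤ m) π → PeakFree π → PeakFree (π ∷ʳ m)
peakFree-max-last []          []        = [] ∷ []
peakFree-max-last (_ ∷ π≤m) (px ∷ pf) =
  AllPairs.++⁺ px ([] ∷ []) (All.map (λ y≤m → (λ (_ , m<y) → ≤⇒≯ y≤m m<y) ∷ []) π≤m)
    ∷ peakFree-max-last π≤m pf

peakFree-++⁻ˡ : ∀ xs {ys} → PeakFree (xs ++ ys) → PeakFree xs
peakFree-++⁻ˡ []       _         = []
peakFree-++⁻ˡ (x ∷ xs) (px ∷ pf) = AllPairs-++⁻ˡ xs px ∷ peakFree-++⁻ˡ xs pf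

-- Codes

data Side : Set where
  left right : Side

-- A code of length n says at which end of the word each of the letters
-- 2, ..., n + 1 is added to the word 1.  The head of the list belongs to the
-- largest letter, which is added last.
Code : Set
Code = List Side

arrange : Code → Word
arrange []          = [ 1 ]
arrange (left ∷ c)  = suc (suc (length c)) ∷ arrange c
arrange (right ∷ c) = arrange c ∷ʳ suc (suc (length c))

-- The numbers m - 1 for the letters m added on the left, in decreasing order.
parts : Code → List ℕ
parts []          = []
parts (left ∷ c)  = suc (length c) ∷ parts c
parts (right ∷ c) = parts c

-- The codes that arrange to an indecomposable permutation: the largest letter
-- is 1 or stands first.
Canonical : Pred Code Level.zero
Canonical []          = ⊤
Canonical (left ∷ _)  = ⊤
Canonical (right ∷ _) = ⊥

canonical? : Decidable Canonical
canonical? []          = yes tt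
canonical? (left ∷ _)  = yes tt
canonical? (right ∷ _) = no λ ()

CanonicalOfSum : ℕ → Pred Code Level.zero
CanonicalOfSum k c = Canonical c × sum (parts c) ≡ k

-- All codes of length at most n.
codesUpTo : ℕ → List Code
codesUpTo zero    = [ [] ]
codesUpTo (suc n) = [] ∷ map (left ∷_) (codesUpTo n) ++ map (right ∷_) (codesUpTo n)

codesUpTo-complete : ∀ {n} c → length c ≤ n → c ∈ codesUpTo n
codesUpTo-complete {zero}  []          _         = here refl
codesUpTo-complete {suc n} []          _         = here refl
codesUpTo-complete {suc n} (left ∷ c)  (s≤s c≤n) =
  there (∈-++⁺ˡ (∈-map⁺ (left ∷_) (codesUpTo-complete c c≤n)))
codesUpTo-complete {suc n} (right ∷ c) (s≤s c≤n) =
  there (∈-++⁺ʳ _ (∈-map⁺ (right ∷_) (codesUpTo-complete c c≤n)))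

codesUpTo-unique : ∀ n → Unique (codesUpTo n)
codesUpTo-unique zero    = [] ∷ []
codesUpTo-unique (suc n) =
  All.++⁺ (All.map⁺ (All.universal (λ _ ()) (codesUpTo n)))
          (All.map⁺ (All.universal (λ _ ()) (codesUpTo n)))
  ∷ Unique.++⁺ (Unique.map⁺ ∷-injectiveʳ (codesUpTo-unique n))
               (Unique.map⁺ ∷-injectiveʳ (codesUpTo-unique n))
               (λ (∈left , ∈right) → case ∈-map⁻ (left ∷_) ∈left , ∈-map⁻ (right ∷_) ∈right of
                 λ { ((_ , _ , refl) , (_ , _ , ())) })

canonical-length : ∀ c → Canonical c → length c ≤ sum (parts c)
canonical-length []         _ = z≤n
canonical-length (left ∷ c) _ = m≤m+n (suc (length c)) (sum (parts c))

-- By `canonical-length`, only codes of length at most k have to be searched.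
codes-finite : ∀ k → ∃[ n ] CanonicalOfSum k HasCardinality n
codes-finite k =
  _ , filter ofSum? (codesUpTo k)
    , Unique.filter⁺ ofSum? (codesUpTo-unique k)
    , (λ c → mk⇔ (λ c∈ → proj₂ (∈-filter⁻ ofSum? {xs = codesUpTo k} c∈))
                 (λ (can , eq) → ∈-filter⁺ ofSum?
                    (codesUpTo-complete c (subst (length c ≤_) eq (canonical-length c can)))
                    (can , eq)))
    , refl
  where
  ofSum? : Decidable (CanonicalOfSum k)
  ofSum? c = canonical? c ×-dec (sum (parts c) ≟ k)

-- Canonical codes and partitions into distinct parts

parts-bounded : ∀ c → All (_≤ length c) (parts c)
parts-bounded []          = []
parts-bounded (left ∷ c)  = ≤-refl ∷ All.map m≤n⇒m≤1+n (parts-bounded c)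
parts-bounded (right ∷ c) = All.map m≤n⇒m≤1+n (parts-bounded c)

parts-decreasing : ∀ c → AllPairs _>_ (parts c)
parts-decreasing []          = []
parts-decreasing (left ∷ c)  = All.map s≤s (parts-bounded c) ∷ parts-decreasing c
parts-decreasing (right ∷ c) = parts-decreasing c

parts-positive : ∀ c → All (_> 0) (parts c)
parts-positive []          = []
parts-positive (left ∷ c)  = z<s ∷ parts-positive c
parts-positive (right ∷ c) = parts-positive c

-- Without canonicity, the parts determine a code only once its length is known:
-- choices on the right at the head of the list leave no trace in the parts.
parts-injective-length : ∀ c d → length c ≡ length d → parts c ≡ parts d → c ≡ d
parts-injective-length []          []          _   _  = refl
parts-injective-length (left ∷ c)  (left ∷ d)  len eq =
  cong (left ∷_) (parts-injective-length c d (suc-injective len) (∷-injectiveʳ eq))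
parts-injective-length (right ∷ c) (right ∷ d) len eq =
  cong (right ∷_) (parts-injective-length c d (suc-injective len) eq)
parts-injective-length (left ∷ c)  (right ∷ d) len eq
  with p≤d ∷ _ ← subst (All (_≤ length d)) (sym eq) (parts-bounded d) =
  contradiction p≤d (<⇒≱ (≤-reflexive (sym len)))
parts-injective-length (right ∷ c) (left ∷ d)  len eq
  with p≤c ∷ _ ← subst (All (_≤ length c)) eq (parts-bounded c) =
  contradiction p≤c (<⇒≱ (≤-reflexive len))

parts-injective : ∀ {c d} → Canonical c → Canonical d → parts c ≡ parts d → c ≡ d
parts-injective {[]}       {[]}       _ _ _  = refl
parts-injective {[]}       {left ∷ d} _ _ ()
parts-injective {left ∷ c} {[]}       _ _ ()
parts-injective {left ∷ c} {left ∷ d} _ _ eq =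
  parts-injective-length (left ∷ c) (left ∷ d) (∷-injectiveˡ eq) eq

parts-surjective-length : ∀ n ps → AllPairs _>_ ps → All (_> 0) ps → All (_≤ n) ps →
                          ∃[ c ] length c ≡ n × ps ≡ parts c
parts-surjective-length zero    []       _ _ _ = [] , refl , refl
parts-surjective-length zero    (p ∷ ps) _ (p>0 ∷ _) (p≤0 ∷ _) = contradiction p>0 (≤⇒≯ p≤0)
parts-surjective-length (suc n) []       _ _ _
  with c , len , eq ← parts-surjective-length n [] [] [] [] = right ∷ c , cong suc len , eq
parts-surjective-length (suc n) (p ∷ ps) (p>ps ∷ dec) (p>0 ∷ pos) (p≤1+n ∷ _) with p ≟ suc n
... | yes refl with c , refl , eq ← parts-surjective-length n ps dec pos (All.map s≤s⁻¹ p>ps) =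
  left ∷ c , refl , cong (_ ∷_) eq
... | no p≢1+n
  with p≤n ← s≤s⁻¹ (≤∧≢⇒< p≤1+n p≢1+n)
  with c , len , eq ← parts-surjective-length n (p ∷ ps) (p>ps ∷ dec) (p>0 ∷ pos)
                        (p≤n ∷ All.map (λ p>q → ≤-trans (<⇒≤ p>q) p≤n) p>ps) =
  right ∷ c , cong suc len , eq

parts-surjective : ∀ ps → AllPairs _>_ ps → All (_> 0) ps → ∃[ c ] Canonical c × ps ≡ parts c
parts-surjective []           _            _         = [] , tt , refl
parts-surjective (suc q ∷ ps) (p>ps ∷ dec) (_ ∷ pos)
  with c , refl , eq ← parts-surjective-length q ps dec pos (All.map s≤s⁻¹ p>ps) =
  left ∷ c , tt , cong (_ ∷_) eq

partitions-cardinality : ∀ {k n} → CanonicalOfSum k HasCardinality n →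
                         IsPartitionIntoDistinctParts k HasCardinality n
partitions-cardinality {k} = HasCardinality-map parts
  (λ (can , _) (can′ , _) → parts-injective can can′)
  (λ {c} (_ , eq) →
      ( AllPairs⇒Linked (AllPairs.map <⇒≤ (parts-decreasing c)) , parts-positive c , eq)
      , AllPairs.map >⇒≢ (parts-decreasing c))
  complete
  where
  complete : ∀ {ps} → IsPartitionIntoDistinctParts k ps → ∃[ c ] CanonicalOfSum k c × ps ≡ parts c
  complete {ps} ((linked , pos , refl) , unique)
    with c , can , refl ← parts-surjective ps
           (AllPairs.zipWith (λ (p≥q , p≢q) → ≤∧≢⇒< p≥q (p≢q ∘ sym))
             (Linked⇒AllPairs (λ x≥y y≥z → ≤-trans y≥z x≥y) linked , unique))
           pos =
    c , (can , refl) , refl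

-- Canonical codes and indecomposable permutations

arrange-↭ : ∀ c → arrange c ↭ applyUpTo suc (suc (length c))
arrange-↭ []          = ↭-refl
arrange-↭ (left ∷ c)  = ↭-trans (prep _ (arrange-↭ c))
  (↭-trans (∷↭∷ʳ _ _) (↭-reflexive (applyUpTo-∷ʳ suc (suc (length c)))))
arrange-↭ (right ∷ c) = ↭-trans (++⁺ʳ _ (arrange-↭ c))
  (↭-reflexive (applyUpTo-∷ʳ suc (suc (length c))))

length-arrange : ∀ c → length (arrange c) ≡ suc (length c)
length-arrange c = trans (↭-length (arrange-↭ c)) (length-applyUpTo suc (suc (length c)))

arrange-isPermutation : ∀ c → IsPermutation (arrange c)
arrange-isPermutation c =
  subst (λ n → arrange c ↭ applyUpTo suc n) (sym (length-arrange c)) (arrange-↭ c)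

arrange-bounded : ∀ c → All (_≤ suc (length c)) (arrange c)
arrange-bounded c = permutation-bounded (arrange-↭ c)

arrange-peakFree : ∀ c → PeakFree (arrange c)
arrange-peakFree []          = [] ∷ []
arrange-peakFree (left ∷ c)  =
  peakFree-max-first (All.map m≤n⇒m≤1+n (arrange-bounded c)) (arrange-peakFree c)
arrange-peakFree (right ∷ c) =
  peakFree-max-last (All.map m≤n⇒m≤1+n (arrange-bounded c)) (arrange-peakFree c)

inversions-arrange : ∀ c → inversions (arrange c) ≡ sum (parts c)
inversions-arrange []          = refl
inversions-arrange (left ∷ c)  =
  trans (inversions-max-first (All.map s≤s (arrange-bounded c)))
        (cong₂ _+_ (length-arrange c) (inversions-arrange c))
inversions-arrange (right ∷ c) =
  trans (inversions-max-last (All.map m≤n⇒m≤1+n (arrange-bounded c))) (inversions-arrange c)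

max-first-indecomposable : ∀ w → Indecomposable (suc (length w) ∷ w)
max-first-indecomposable w = (λ ()) , λ
  { ([]    , _     , _  , _ , ρ≢[] , _    , _ ) → ρ≢[] refl
  ; (_ ∷ _ , []    , _  , _ , _    , τ≢[] , _ ) → τ≢[] refl
  ; (r ∷ ρ , t ∷ τ , ρ↭ , _ , _    , _    , eq) → absurd r ρ t τ ρ↭ eq
  }
  where
  -- The first letter of ρ would exceed the length of ρ.
  absurd : ∀ r ρ t τ → IsPermutation (r ∷ ρ) → ¬ (suc (length w) ∷ w ≡ (r ∷ ρ) ⊕ (t ∷ τ))
  absurd r ρ t τ ρ↭ eq with refl , w≡ ← ∷-injective eq with r≤ ∷ _ ← permutation-bounded ρ↭ =
    m+1+n≰m (length ρ) (subst (_≤ length ρ) |w| (s≤s⁻¹ r≤))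
    where
    |w| : length w ≡ length ρ + suc (length τ)
    |w| = trans (cong length w≡)
            (trans (length-++ ρ) (cong (λ n → length ρ + suc n) (length-map _ τ)))

canonical⇒indecomposable : ∀ c → Canonical c → Indecomposable (arrange c)
canonical⇒indecomposable []         _ = max-first-indecomposable []
canonical⇒indecomposable (left ∷ c) _ =
  subst (λ n → Indecomposable (suc n ∷ arrange c)) (length-arrange c)
    (max-first-indecomposable (arrange c))

arrange-right-decomposable : ∀ c → Decomposable (arrange (right ∷ c))
arrange-right-decomposable c =
  arrange c , [ 1 ] , arrange-isPermutation c , ↭-refl , arrange≢[] , (λ ())
  , cong (arrange c ∷ʳ_) (trans (cong suc (sym (length-arrange c))) (+-comm 1 _))
  where
  arrange≢[] : arrange c ≢ []
  arrange≢[] eq = 1+n≢0 (trans (sym (length-arrange c)) (cong length eq))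

indecomposable⇒canonical : ∀ c → Indecomposable (arrange c) → Canonical c
indecomposable⇒canonical []          _         = tt
indecomposable⇒canonical (left ∷ c)  _         = tt
indecomposable⇒canonical (right ∷ c) (_ , ind) = contradiction (arrange-right-decomposable c) ind

arrange-left≢right : ∀ c d → length c ≡ length d → arrange (left ∷ c) ≢ arrange (right ∷ d)
arrange-left≢right c d len eq with arrange d | length-arrange d | arrange-bounded d
... | x ∷ _ | _ | x≤ ∷ _ with refl ← ∷-injectiveˡ eq = <⇒≱ (s≤s (s≤s (≤-reflexive (sym len)))) x≤

arrange-injective : ∀ c d → arrange c ≡ arrange d → c ≡ d
arrange-injective c d eq = go c d same-length eq
  where
  same-length : length c ≡ length d
  same-length = suc-injective
    (trans (sym (length-arrange c)) (trans (cong length eq) (length-arrange d)))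

  go : ∀ c d → length c ≡ length d → arrange c ≡ arrange d → c ≡ d
  go []          []          _   _  = refl
  go (left ∷ c)  (left ∷ d)  len eq = cong (left ∷_) (go c d (suc-injective len) (∷-injectiveʳ eq))
  go (right ∷ c) (right ∷ d) len eq =
    cong (right ∷_) (go c d (suc-injective len) (∷ʳ-injectiveˡ (arrange c) (arrange d) eq))
  go (left ∷ c)  (right ∷ d) len eq = contradiction eq (arrange-left≢right c d (suc-injective len))
  go (right ∷ c) (left ∷ d)  len eq =
    contradiction (sym eq) (arrange-left≢right d c (sym (suc-injective len)))

-- The largest letter of a peak-free permutation stands at one of the two
-- ends, for otherwise it would have smaller letters on both sides.
arrange-surjective : ∀ n π → π ↭ applyUpTo suc (suc n) → PeakFree π →
                     ∃[ c ] length c ≡ n × π ≡ arrange c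
arrange-surjective zero    π π↭ _  = [] , refl , ↭-singleton-inv π↭
arrange-surjective (suc n) π π↭ pf
  with xs , ys , refl ← ∈-∃++ (∈-resp-↭ (↭-sym π↭)
         (subst (suc (suc n) ∈_) (applyUpTo-∷ʳ suc (suc n)) (∈-++⁺ʳ (applyUpTo suc (suc n)) (here refl))))
  = split xs ys
      (subst (xs ++ ys ↭_) (++-identityʳ _)
        (drop-mid xs (applyUpTo suc (suc n))
          (↭-trans π↭ (↭-reflexive (sym (applyUpTo-∷ʳ suc (suc n)))))))
      pf
  where
  split : ∀ xs ys → xs ++ ys ↭ applyUpTo suc (suc n) → PeakFree (xs ++ suc (suc n) ∷ ys) →
          ∃[ c ] length c ≡ suc n × xs ++ suc (suc n) ∷ ys ≡ arrange c
  split []       ys       rest↭ (_ ∷ pf)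
    with c , refl , eq ← arrange-surjective n ys rest↭ pf =
    left ∷ c , refl , cong (_ ∷_) eq
  split (x ∷ xs) []       rest↭ pf
    with c , refl , eq ← arrange-surjective n (x ∷ xs)
           (subst (_↭ applyUpTo suc (suc n)) (++-identityʳ (x ∷ xs)) rest↭)
           (peakFree-++⁻ˡ (x ∷ xs) pf) =
    right ∷ c , refl , cong (_∷ʳ suc (suc n)) eq
  split (x ∷ xs) (y ∷ ys) rest↭ (px ∷ _)
    with x≤ ∷ rest≤ ← permutation-bounded rest↭
    with y≤ ∷ _ ← All.++⁻ʳ xs rest≤
    with (¬peak ∷ _) ∷ _ ← AllPairs-++⁻ʳ xs px =
    contradiction (s≤s x≤ , s≤s y≤) ¬peak

I-cardinality : ∀ {k n} → CanonicalOfSum k HasCardinality n → I k 132∧231 HasCardinality n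
I-cardinality {k} = HasCardinality-map arrange
  (λ _ _ → arrange-injective _ _)
  (λ {c} (can , eq) →
      arrange-isPermutation c , canonical⇒indecomposable c can
      , trans (inversions-arrange c) eq , peakFree⇒avoids (arrange-peakFree c))
  complete
  where
  complete : ∀ {π} → I k 132∧231 π → ∃[ c ] CanonicalOfSum k c × π ≡ arrange c
  complete {[]}    (_  , (π≢[] , _) , _    , _     ) = contradiction refl π≢[]
  complete {x ∷ π} (π↭ , ind        , refl , avoids)
    with c , _ , eq ← arrange-surjective (length π) (x ∷ π) π↭
                        (avoids⇒peakFree (permutation-unique π↭) avoids) =
    c , ( indecomposable⇒canonical c (subst Indecomposable eq ind)
        , trans (sym (inversions-arrange c)) (cong inversions (sym eq))) , eq

theorem18 : ∀ (k : ℕ) →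
    ∃[ n ] (I k ((1 ∷ 3 ∷ 2 ∷ []) ∷ (2 ∷ 3 ∷ 1 ∷ []) ∷ []) HasCardinality n
    × IsPartitionIntoDistinctParts k HasCardinality n)
theorem18 k with n , codes ← codes-finite k = n , I-cardinality codes , partitions-cardinality codes
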